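{- The map $f$ defined below is a bijection from $\mathcal{G}_2$ onto $\mathcal{A}_2$, and $f(\pi)$ is a partition of the same integer as $\pi$.
   Context: Partitions are nonincreasing finite sequences of positive integers; $m_j(\pi)$ is the multiplicity of $j$ in $\pi$, $\ell(\pi)$ the number of parts, and $\pi\cup\lambda$ the partition formed by all parts of both (as a multiset). $\langle a^{m}\rangle$ denotes the partition consisting of $m$ copies of $a$. $\mathcal{G}_2$ is the set of partitions $\pi$ with $m_1(\pi)\le 1$ and $m_j(\pi)+m_{j+1}(\pi)\le 2$ for all $j\ge1$. For $\pi\in\mathcal{G}_2$ every part has multiplicity at most $2$. Let $D(\pi)$ be the number of distinct parts of multiplicity $2$, let $R_1(\pi)>R_2(\pi)>\dots>R_{D(\pi)}(\pi)$ be these parts, and set $R_{D(\pi)+1}(\pi)=0$, $R_0(\pi)=\infty$. For $0\le k\le D(\pi)$ let $\pi^{(k)}$ be the partition consisting of the parts of $\pi$ strictly between $R_{k+1}(\pi)$ and $R_k(\pi)$ (these parts are distinct). For a partition $\mu$ and integer $c$, $\mu+\langle c^{\ell(\mu)}\rangle$ denotes $\mu$ with $c$ added to each part. Define $$f(\pi)=\bigcup_{i=1}^{D(\pi)}\big\langle (2i)^{R_i(\pi)-R_{i+1}(\pi)-\ell(\pi^{(i)})}\big\rangle\ \cup\ \bigcup_{i=0}^{D(\pi)}\Big(\pi^{(i)}+\langle (2i)^{\ell(\pi^{(i)})}\rangle\Big).$$ For a partition $\lambda$, $R_1(\lambda)$ is its largest part of multiplicity $\ge2$ (or $0$ if none).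 $\mathcal{A}_2$ is the set of partitions $\lambda$ such that $m_j(\lambda)\le1$ for odd $j$, $m_j(\lambda)=0$ for odd $j<R_1(\lambda)$, and $m_j(\lambda)\ge 2$ for even $j$ with $0<j<R_1(\lambda)$. -}

module Defs where

open import Data.List.Base
  using (List; []; _∷_; length; map; filter; replicate; merge; deduplicate; applyUpTo; foldr)
open import Data.List.Extrema.Nat using (max)
open import Data.List.Relation.Binary.Permutation.Propositional using (↭-sym)
open import Data.List.Relation.Binary.Permutation.Propositional.Properties
  using (All-resp-↭; merge-↭)
open import Data.List.Relation.Unary.All as All using (All; [])
import Data.List.Relation.Unary.All.Properties as All
open import Data.List.Relation.Unary.Linked as Linked using (Linked; []; [-]; _∷_)
import Data.List.Relation.Unary.Linked.Properties as Linked
open import Data.List.Relation.Unary.Sorted.TotalOrder.Properties using (merge⁺)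
open import Data.Nat.Base using (ℕ; zero; suc; _+_; _*_; _∸_; _≤_; _≥_; _<_; NonZero; >-nonZero⁻¹)
open import Data.Nat.ListAction using (sum)
open import Data.Nat.Divisibility using (_∣_; _∤_)
open import Data.Nat.Properties
  using (_≟_; _≤?_; _<?_; _≥?_; ≤-refl; ≤-trans; ≤-decTotalOrder; +-monoˡ-≤; m≤m+n)
open import Function.Base using (flip)
open import Relation.Binary.Bundles using (DecTotalOrder)
import Relation.Binary.Construct.Add.Supremum.Strict as Supremum
import Relation.Binary.Construct.Flip.EqAndOrd as Flip
open import Relation.Binary.PropositionalEquality.Core using (_≡_)
open import Relation.Nullary.Construct.Add.Supremum using (_⁺; ⊤⁺; [_])
open import Relation.Nullary.Decidable using (_×-dec_)

------------------------------------------------------------------------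
-- Partitions

-- Both properties are propositions, so partitions with the same list
-- of parts are propositionally equal.

record Partition : Set where
  constructor mkPartition
  field
    parts         : List ℕ
    nonincreasing : Linked _≥_ parts
    positive      : All (0 <_) parts

open Partition public

size : Partition → ℕ
size π = sum (parts π)

ℓ : Partition → ℕ
ℓ π = length (parts π)

mult : ℕ → Partition → ℕ
mult j π = length (filter (j ≟_) (parts π))

∅ : Partition
∅ = mkPartition [] [] []

infixr 6 _∪_

_∪_ : Partition → Partition → Partition
π ∪ σ = mkPartition
  (merge _≥?_ (parts π) (parts σ))
  (merge⁺ ≥-decTotalOrder (nonincreasing π) (nonincreasing σ))
  (All-resp-↭ (↭-sym (merge-↭ _≥?_ (parts π) (parts σ)))
              (All.++⁺ (positive π) (positive σ)))
  where
  ≥-decTotalOrder : DecTotalOrder _ _ _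
  ≥-decTotalOrder = Flip.decTotalOrder ≤-decTotalOrder

⋃ : List Partition → Partition
⋃ = foldr _∪_ ∅

⟨_^_⟩ : (a m : ℕ) → .{{NonZero a}} → Partition
⟨ a ^ m ⟩ = mkPartition
  (replicate m a)
  (constant m)
  (All.replicate⁺ m (>-nonZero⁻¹ a))
  where
  constant : ∀ m → Linked _≥_ (replicate m a)
  constant zero          = []
  constant (suc zero)    = [-]
  constant (suc (suc m)) = ≤-refl ∷ constant (suc m)

addToEachPart : ℕ → Partition → Partition
addToEachPart c μ = mkPartition
  (map (_+ c) (parts μ))
  (Linked.map⁺ (Linked.map (+-monoˡ-≤ c) (nonincreasing μ)))
  (All.map⁺ (All.map (λ {j} 0<j → ≤-trans 0<j (m≤m+n j c)) (positive μ)))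

------------------------------------------------------------------------
-- Domain and codomain of f

record 𝒢₂ (π : Partition) : Set where
  field
    mult-one      : mult 1 π ≤ 1
    mult-adjacent : ∀ j → 1 ≤ j → mult j π + mult (suc j) π ≤ 2

largestRepeated : Partition → ℕ
largestRepeated π = max 0 (filter (λ j → 2 ≤? mult j π) (parts π))

record 𝒜₂ (π : Partition) : Set where
  field
    odd-distinct  : ∀ j → 2 ∤ j → mult j π ≤ 1
    odd-absent    : ∀ j → 2 ∤ j → j < largestRepeated π → mult j π ≡ 0
    even-repeated : ∀ j → 2 ∣ j → 0 < j → j < largestRepeated π → 2 ≤ mult j π

------------------------------------------------------------------------
-- The map f

-- In decreasing order, since the parts are nonincreasing.

doubledParts : Partition → List ℕ
doubledParts π = deduplicate _≟_ (filter (λ j → mult j π ≟ 2) (parts π))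

D : Partition → ℕ
D π = length (doubledParts π)

nthOr0 : List ℕ → ℕ → ℕ
nthOr0 []       _       = 0
nthOr0 (x ∷ xs) zero    = x
nthOr0 (x ∷ xs) (suc i) = nthOr0 xs i

-- R₁₊ π i is the finite value R_{1+i}(π); in particular R₁₊ π (D π) ≡ 0.

R₁₊ : Partition → ℕ → ℕ
R₁₊ π i = nthOr0 (doubledParts π) i

R : Partition → ℕ → ℕ ⁺
R π zero    = ⊤⁺
R π (suc i) = [ R₁₊ π i ]

open Supremum _<_ using (_<⁺_; <⁺-dec)

-- block π k is π^(k), the parts of π strictly between R_{k+1}(π) and R_k(π).

block : Partition → ℕ → Partition
block π k = mkPartition
  (filter between? (parts π))
  (Linked.filter⁺ between? (flip ≤-trans) (nonincreasing π))
  (All.filter⁺ between? (positive π))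
  where
  between? = λ j → <⁺-dec _<?_ (R π (suc k)) [ j ] ×-dec <⁺-dec _<?_ [ j ] (R π k)

-- The first union runs over i = 1 , … , D π, written as suc i with i < D π.
-- For π in 𝒢₂ the subtraction ∸ is never truncated; outside 𝒢₂ the value
-- of f is irrelevant.

f : Partition → Partition
f π =
  ⋃ (applyUpTo (λ i → ⟨ 2 * suc i ^ R₁₊ π i ∸ R₁₊ π (suc i) ∸ ℓ (block π (suc i)) ⟩) (D π))
  ∪
  ⋃ (applyUpTo (λ i → addToEachPart (2 * i) (block π i)) (suc (D π)))

{-# OPTIONS --safe #-}
module Submission where

-- If x is the largest repeated part of π and π′ consists of the parts below x,
-- then f π is obtained from the Young diagram of f π′, which has at most x − 2
-- rows, by adding two new first columns of length x, together with the parts of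
-- π above x. Hence f preserves the size. Conversely, as long as an image has
-- repeated parts, its largest part was added unchanged exactly when it exceeds
-- the number of parts; otherwise the number of parts is the largest repeated
-- part of π, and one removes the first two columns. 𝒜₂ is the class of
-- partitions obtained from partitions into distinct parts by repeatedly adding
-- two equal first columns longer by at least two than the old one, and it is
-- stable under these operations and their inverses.

open import Defs
open import Data.Product using (Σ-syntax; _×_; proj₁; map)
open import Function using (_on_)
open import Function.Definitions using (Bijective)
open import Relation.Binary.PropositionalEquality using (_≡_)

open import Data.Empty using (⊥)
open import Data.List.Base as List
  using (List; []; _∷_; _++_; length; filter; replicate; concat; applyUpTo; deduplicate)
open import Data.List.Extrema.Nat using (xs≤max; argmax-sel)
open import Data.List.Membership.Propositional using (_∈_)
open import Data.List.Membership.Propositional.Properties using (∈-filter⁺; ∈-filter⁻)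
open import Data.List.Properties
open import Data.List.Relation.Binary.Permutation.Propositional
  using (_↭_; ↭-refl; ↭-trans; prep; ↭⇒↭ₛ; module PermutationReasoning)
import Data.List.Relation.Binary.Permutation.Propositional.Properties as Perm
open import Data.List.Relation.Binary.Pointwise using (Pointwise-≡⇒≡)
open import Data.List.Relation.Unary.All as All using (All; []; _∷_)
import Data.List.Relation.Unary.All.Properties as All
open import Data.List.Relation.Unary.Any using (here; there)
open import Data.List.Relation.Unary.Linked as Linked using (Linked; []; [-]; _∷_)
open import Data.List.Relation.Unary.Sorted.TotalOrder.Properties using (↗↭↗⇒≋)
open import Data.Nat.Base
open import Data.Nat.Divisibility
  using (_∣_; _∤_; _∣?_; ∣m+n∣m⇒∣n; ∣m∣n⇒∣m+n; ∣-refl; _∣0; ∣1⇒≡1)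
open import Data.Nat.ListAction using (sum)
open import Data.Nat.Properties
open import Data.Nat.Solver using (module +-*-Solver)
open import Data.Product using (∃; _,_; proj₂)
open import Data.Sum.Base using (_⊎_; inj₁; inj₂)
open import Function.Base using (_∘_; id)
open import Function.Bundles using (_⇔_; mk⇔; Equivalence)
open import Relation.Binary.Definitions using (tri<; tri≈; tri>)
import Relation.Binary.Construct.Add.Supremum.Strict as Supremum
import Relation.Binary.Construct.Flip.EqAndOrd as Flip
open import Relation.Binary.PropositionalEquality
  using (_≢_; refl; sym; trans; cong; cong₂; subst; module ≡-Reasoning)
open import Relation.Nullary.Construct.Add.Supremum using (_⁺; ⊤⁺; [_])
open import Relation.Nullary.Decidable using (yes; no; ¬?; _×-dec_)
open import Relation.Nullary.Negation using (¬_; contradiction)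
open import Relation.Unary using (Pred; Decidable)

-- Multiplicities in lists.

count : ℕ → List ℕ → ℕ
count j xs = length (filter (j ≟_) xs)

module _ (j : ℕ) where

  count-here : ∀ xs → count j (j ∷ xs) ≡ suc (count j xs)
  count-here xs = cong length (filter-accept (j ≟_) {xs = xs} refl)

  count-there : ∀ {x} xs → j ≢ x → count j (x ∷ xs) ≡ count j xs
  count-there xs j≢x = cong length (filter-reject (j ≟_) {xs = xs} j≢x)

  count-∷-≤ : ∀ x xs → count j xs ≤ count j (x ∷ xs)
  count-∷-≤ x xs with j ≟ x
  ... | yes refl = ≤-trans (n≤1+n _) (≤-reflexive (sym (count-here xs)))
  ... | no j≢x   = ≤-reflexive (sym (count-there xs j≢x))

  count-none : ∀ {xs} → All (j ≢_) xs → count j xs ≡ 0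
  count-none = cong length ∘ filter-none (j ≟_)

  count-above : ∀ {xs} → All (_< j) xs → count j xs ≡ 0
  count-above = count-none ∘ All.map (λ x<j j≡x → <⇒≢ x<j (sym j≡x))

  count-∈ : ∀ {xs} → j ∈ xs → 1 ≤ count j xs
  count-∈ {x ∷ xs} (here refl) = ≤-trans (s≤s z≤n) (≤-reflexive (sym (count-here xs)))
  count-∈ {x ∷ xs} (there j∈)  = ≤-trans (count-∈ j∈) (count-∷-≤ x xs)

-- Words encoding the partitions in `𝒢₂`.

infixr 5 _∷₁_ _∷₂_

-- The multiplicity, 1 or 2, of each distinct part sits in the constructor, so a doubled part is a
-- single step of every recursion from the largest part down.
data Word : Set where
  []        : Word
  _∷₁_ _∷₂_ : ℕ → Word → Word

word-parts : Word → List ℕ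
word-parts []       = []
word-parts (x ∷₁ w) = x ∷ word-parts w
word-parts (x ∷₂ w) = x ∷ x ∷ word-parts w

-- The value 0 at the empty word turns the requirement `2 + top w ≤ x` on a doubled part into x ≥ 2
-- there, which is the condition that 1 is not repeated.
top : Word → ℕ
top []       = 0
top (x ∷₁ w) = x
top (x ∷₂ w) = x

-- The least part that 𝒢₂ lets one put once above w; a part can be put
-- twice above w if it is at least 2 + top w.
low : Word → ℕ
low []       = 1
low (x ∷₁ w) = 1 + x
low (x ∷₂ w) = 2 + x

data Valid : Word → Set where
  []   : Valid []
  _∷₁_ : ∀ {x w} → low w ≤ x → Valid w → Valid (x ∷₁ w)
  _∷₂_ : ∀ {x w} → 2 + top w ≤ x → Valid w → Valid (x ∷₂ w)

top<low : ∀ w → top w < low w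
top<low []       = s≤s z≤n
top<low (x ∷₁ w) = ≤-refl
top<low (x ∷₂ w) = n≤1+n _

low≤2+top : ∀ w → low w ≤ 2 + top w
low≤2+top []       = s≤s z≤n
low≤2+top (x ∷₁ w) = n≤1+n _
low≤2+top (x ∷₂ w) = ≤-refl

low≤⇒top< : ∀ w {x} → low w ≤ x → top w < x
low≤⇒top< w = ≤-trans (top<low w)

2+top≤⇒top< : ∀ w {x} → 2 + top w ≤ x → top w < x
2+top≤⇒top< w = ≤-trans (n≤1+n _)

parts≤top : ∀ {w} → Valid w → All (_≤ top w) (word-parts w)
parts≤top []                  = []
parts≤top (_∷₁_ {x} {w} l v) = ≤-refl ∷ All.map (λ y≤ → ≤-trans y≤ (<⇒≤ (low≤⇒top< w l))) (parts≤top v)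
parts≤top (_∷₂_ {x} {w} l v) = ≤-refl ∷ ≤-refl ∷ All.map (λ y≤ → ≤-trans y≤ (<⇒≤ (2+top≤⇒top< w l))) (parts≤top v)

parts<₁ : ∀ {x w} → low w ≤ x → Valid w → All (_< x) (word-parts w)
parts<₁ {x} {w} l v = All.map (λ y≤ → ≤-<-trans y≤ (low≤⇒top< w l)) (parts≤top v)

parts<₂ : ∀ {x w} → 2 + top w ≤ x → Valid w → All (_< x) (word-parts w)
parts<₂ {x} {w} l v = All.map (λ y≤ → ≤-<-trans y≤ (2+top≤⇒top< w l)) (parts≤top v)

nonincreasing-head : ∀ {x xs} → Linked _≥_ (x ∷ xs) → All (_≤ x) xs
nonincreasing-head [-]        = []
nonincreasing-head (y≤x ∷ ls) = y≤x ∷ All.map (λ z≤y → ≤-trans z≤y y≤x) (nonincreasing-head ls)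

cons-nonincreasing : ∀ {x xs} → All (_≤ x) xs → Linked _≥_ xs → Linked _≥_ (x ∷ xs)
cons-nonincreasing []        _  = [-]
cons-nonincreasing (y≤x ∷ _) ls = y≤x ∷ ls

word-nonincreasing : ∀ {w} → Valid w → Linked _≥_ (word-parts w)
word-nonincreasing []       = []
word-nonincreasing (l ∷₁ v) = cons-nonincreasing (All.map <⇒≤ (parts<₁ l v)) (word-nonincreasing v)
word-nonincreasing (l ∷₂ v) = ≤-refl ∷ cons-nonincreasing (All.map <⇒≤ (parts<₂ l v)) (word-nonincreasing v)

low>0 : ∀ w → 0 < low w
low>0 w = ≤-trans (s≤s z≤n) (top<low w)

word-positive : ∀ {w} → Valid w → All (0 <_) (word-parts w)
word-positive []                 = []
word-positive (_∷₁_ {w = w} l v) = ≤-trans (low>0 w) l ∷ word-positive v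
word-positive (l ∷₂ v)           = 0<x ∷ 0<x ∷ word-positive v
  where 0<x = ≤-trans (s≤s z≤n) l

-- Valid words are the partitions in `𝒢₂`.

Is𝒢₂ : List ℕ → Set
Is𝒢₂ xs = count 1 xs ≤ 1 × (∀ j → 1 ≤ j → count j xs + count (suc j) xs ≤ 2)

Is𝒢₂-tail : ∀ {x xs} → Is𝒢₂ (x ∷ xs) → Is𝒢₂ xs
Is𝒢₂-tail {x} {xs} (one , adj) =
  ≤-trans (count-∷-≤ _ x xs) one ,
  λ j 1≤j → ≤-trans (+-mono-≤ (count-∷-≤ _ x xs) (count-∷-≤ _ x xs)) (adj j 1≤j)

top∈ : ∀ w → top w ≡ 0 ⊎ top w ∈ word-parts w
top∈ []       = inj₁ refl
top∈ (x ∷₁ w) = inj₂ (here refl)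
top∈ (x ∷₂ w) = inj₂ (here refl)

count-twice : ∀ x xs → count x (x ∷ x ∷ xs) ≡ 2 + count x xs
count-twice x xs = trans (count-here x (x ∷ xs)) (cong suc (count-here x xs))

-- The two copies of x exhaust the bound 2 for the pair x, x + 1 and for the pair x - 1, x, so below
-- them neither x nor x - 1 has room.
double-isolated : ∀ {x z xs} → Is𝒢₂ (x ∷ x ∷ xs) → 0 < z → z ∈ xs → z ≢ x × suc z ≢ x
double-isolated {x} {z} {xs} (_ , adj) 0<z z∈ = (λ { refl → eq z∈ 0<z }) , next
  where
  eq : x ∈ xs → 0 < x → ⊥
  eq x∈ 0<x = <⇒≱ (≤-trans (s≤s (s≤s (count-∈ x x∈))) (≤-reflexive (sym (count-twice x xs))))
                  (≤-trans (m≤m+n _ _) (adj x 0<x))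
  next : suc z ≢ x
  next refl = <⇒≱ (+-mono-≤ {1} {_} {2}
                 (≤-trans (count-∈ z z∈) (≤-trans (count-∷-≤ z x xs) (count-∷-≤ z x (x ∷ xs))))
                 (≤-trans (m≤m+n 2 _) (≤-reflexive (sym (count-twice x xs)))))
              (adj z 0<z)

word-of : ∀ {xs} → Linked _≥_ xs → All (0 <_) xs → Is𝒢₂ xs →
          ∃ λ w → Valid w × word-parts w ≡ xs
word-of {[]}     _ _ _ = [] , [] , refl
word-of {x ∷ []} _ (0<x ∷ _) _ = x ∷₁ [] , 0<x ∷₁ [] , refl
word-of {x ∷ y ∷ r} (y≤x ∷ ls) (0<x ∷ 0<y ∷ ps) g
  -- Equal leading parts consume two entries and unequal ones a single entry, so both recursive
  -- results are prepared.
  with x ≟ y | word-of ls (0<y ∷ ps) (Is𝒢₂-tail g) | word-of (Linked.tail ls) ps (Is𝒢₂-tail (Is𝒢₂-tail g))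
... | yes refl | _ | IH = twice IH
  where
  r≤x : All (_≤ x) r
  r≤x = nonincreasing-head ls
  2≤x : 2 ≤ x
  2≤x = ≤∧≢⇒< 0<x (λ { refl → <⇒≱ (≤-trans (m≤m+n 2 _) (≤-reflexive (sym (count-twice 1 r)))) (proj₁ g) })
  twice : (∃ λ w → Valid w × word-parts w ≡ r) → ∃ λ w → Valid w × word-parts w ≡ x ∷ x ∷ r
  twice (w , v , refl) = x ∷₂ w , fits (top∈ w) ∷₂ v , refl
    where
    fits : top w ≡ 0 ⊎ top w ∈ word-parts w → 2 + top w ≤ x
    fits (inj₁ eq) = subst (λ t → 2 + t ≤ x) (sym eq) 2≤x
    fits (inj₂ t∈) with double-isolated g (All.lookup ps t∈) t∈
    ... | t≢x , 1+t≢x = ≤∧≢⇒< (≤∧≢⇒< (All.lookup r≤x t∈) t≢x) 1+t≢x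
... | no x≢y | IH | _ = once IH
  where
  y<x = ≤∧≢⇒< y≤x (x≢y ∘ sym)
  once : (∃ λ w → Valid w × word-parts w ≡ y ∷ r) → ∃ λ w → Valid w × word-parts w ≡ x ∷ y ∷ r
  once (y ∷₁ w , v , refl) = x ∷₁ y ∷₁ w , y<x ∷₁ v , refl
  once (y ∷₂ w , v , refl) = x ∷₁ y ∷₂ w , ≤∧≢⇒< y<x 1+y≢x ∷₁ v , refl
    where
    ws = word-parts w
    1+y≢x : suc y ≢ x
    1+y≢x refl = <⇒≱ (+-mono-≤ {2} {_} {1}
        (≤-trans (≤-trans (m≤m+n 2 _) (≤-reflexive (sym (count-twice y ws)))) (count-∷-≤ y (suc y) (y ∷ y ∷ ws)))
        (≤-trans (s≤s z≤n) (≤-reflexive (sym (count-here (suc y) (y ∷ y ∷ ws))))))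
      (proj₂ g y 0<y)

-- Serves the pair j, j + 1 when j + 1 is the new single top. The hypothesis forces `top w ≤ j`, and
-- a doubled top j would raise `low` to j + 2.
count≤1-below-low : ∀ {w} → Valid w → ∀ j → low w ≤ suc j → count j (word-parts w) ≤ 1
count≤1-below-low [] j l = z≤n
count≤1-below-low (_∷₁_ {x} {w} m v) j (s≤s x≤j) with j ≟ x
... | yes refl = ≤-reflexive (trans (count-here _ (word-parts w)) (cong suc (count-above _ (parts<₁ m v))))
... | no j≢x  = ≤-trans (≤-reflexive (count-above _
  (≤∧≢⇒< x≤j (j≢x ∘ sym) ∷ All.map (λ y<x → <-≤-trans y<x x≤j) (parts<₁ m v)))) z≤n
count≤1-below-low v@(m ∷₂ _) j (s≤s x<j) =
  ≤-trans (≤-reflexive (count-above _ (All.map (λ y≤x → ≤-<-trans y≤x x<j) (parts≤top v)))) z≤n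

word-Is𝒢₂ : ∀ {w} → Valid w → Is𝒢₂ (word-parts w)
word-Is𝒢₂ [] = z≤n , λ _ _ → z≤n
word-Is𝒢₂ v₀@(_∷₁_ {x} {w} l v) = one , adj
  where
  ws = word-parts w
  IH = word-Is𝒢₂ v
  at-x : count x (x ∷ ws) ≡ 1
  at-x = trans (count-here _ ws) (cong suc (count-above _ (parts<₁ l v)))
  one : count 1 (x ∷ ws) ≤ 1
  one with 1 ≟ x
  ... | yes refl = ≤-reflexive at-x
  ... | no  1≢x  = ≤-trans (≤-reflexive (count-there _ ws 1≢x)) (proj₁ IH)
  adj : ∀ j → 1 ≤ j → count j (x ∷ ws) + count (suc j) (x ∷ ws) ≤ 2
  adj j 1≤j with j ≟ x | suc j ≟ x
  ... | yes refl | _ = ≤-trans (≤-reflexive (cong₂ _+_ at-x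
          (count-above _ (All.map s≤s (parts≤top v₀))))) (s≤s z≤n)
  ... | no j≢x | yes refl = +-mono-≤
          (≤-trans (≤-reflexive (count-there _ ws j≢x)) (count≤1-below-low v j l)) (≤-reflexive at-x)
  ... | no j≢x | no 1+j≢x = ≤-trans
          (≤-reflexive (cong₂ _+_ (count-there _ ws j≢x) (count-there _ ws 1+j≢x))) (proj₂ IH j 1≤j)
word-Is𝒢₂ v₀@(_∷₂_ {x} {w} l v) = one , adj
  where
  ws = word-parts w
  IH = word-Is𝒢₂ v
  at-x : count x (x ∷ x ∷ ws) ≡ 2
  at-x = trans (count-twice x ws) (cong (2 +_) (count-above _ (parts<₂ l v)))
  off-x : ∀ {j} → j ≢ x → count j (x ∷ x ∷ ws) ≡ count j ws
  off-x j≢x = trans (count-there _ (x ∷ ws) j≢x) (count-there _ ws j≢x)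
  one : count 1 (x ∷ x ∷ ws) ≤ 1
  one = ≤-trans (≤-reflexive (off-x (<⇒≢ (≤-trans (s≤s (s≤s z≤n)) l)))) (proj₁ IH)
  adj : ∀ j → 1 ≤ j → count j (x ∷ x ∷ ws) + count (suc j) (x ∷ x ∷ ws) ≤ 2
  adj j 1≤j with j ≟ x | suc j ≟ x
  ... | yes refl | _ = ≤-reflexive (cong₂ _+_ at-x (count-above _ (All.map s≤s (parts≤top v₀))))
  ... | no j≢x | yes refl = ≤-reflexive (cong₂ _+_
          (trans (off-x j≢x) (count-above _ (All.map (λ y≤ → ≤-<-trans y≤ (s≤s⁻¹ l)) (parts≤top v)))) at-x)
  ... | no j≢x | no 1+j≢x = ≤-trans
          (≤-reflexive (cong₂ _+_ (off-x j≢x) (off-x 1+j≢x))) (proj₂ IH j 1≤j)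

-- The image of a word: rows, bounds and size.

-- In terms of Young diagrams: two new first columns, exceeding the old first
-- column by m rows.
widen : ℕ → List ℕ → List ℕ
widen m xs = List.map (2 +_) xs ++ replicate m 2

-- f with its parts listed in decreasing order, by recursion from the top:
-- deleting the largest repeated part x (and everything above it) amounts to
-- deleting the first two columns of the image, which have length x.
image : Word → List ℕ
image []       = []
image (x ∷₁ w) = x ∷ image w
image (x ∷₂ w) = widen (x ∸ length (image w)) (image w)

length-widen : ∀ m xs → length (widen m xs) ≡ length xs + m
length-widen m xs = trans (length-++ (List.map (2 +_) xs))
  (cong₂ _+_ (length-map (2 +_) xs) (length-replicate m))

mutual

  -- A single part adds one row and raises `low` by at least one; a doubled part x brings the number
  -- of rows to exactly x, while `low` becomes x + 2. The latter count needs the old image to have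
  -- at most x rows, so that `∸` is not truncated; hence the mutual induction.
  length-image<low : ∀ {w} → Valid w → length (image w) < low w
  length-image<low []       = s≤s z≤n
  length-image<low (l ∷₁ v) = s≤s (≤-trans (length-image<low v) l)
  length-image<low (l ∷₂ v) = s≤s (≤-trans (≤-reflexive (length-image₂ l v)) (n≤1+n _))

  length-image≤₂ : ∀ {x w} → 2 + top w ≤ x → Valid w → length (image w) ≤ x
  length-image≤₂ {w = w} l v = <⇒≤ (≤-trans (length-image<low v) (≤-trans (low≤2+top w) l))

  length-image₂ : ∀ {x w} → 2 + top w ≤ x → Valid w → length (image (x ∷₂ w)) ≡ x
  length-image₂ {x} {w} l v = trans (length-widen (x ∸ length (image w)) (image w))
    (m+[n∸m]≡n (length-image≤₂ l v))

-- The common summand 2 lets the bound compose directly with the validity condition `2 + top w ≤ x`.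
length-image-gap : ∀ {w} → Valid w → 2 + length (image w) ≤ 2 + top w
length-image-gap []                = ≤-refl
length-image-gap (l ∷₁ v)          = s≤s (s≤s (≤-trans (length-image<low v) l))
length-image-gap (l ∷₂ v)          = s≤s (s≤s (≤-reflexive (length-image₂ l v)))

-- The reason for the gap 2 in validity: the part 2 becomes repeated in the image, as `𝒜₂` demands.
2≤new-rows : ∀ {x w} → 2 + top w ≤ x → Valid w → 2 ≤ x ∸ length (image w)
2≤new-rows {x} {w} l v =
  m+n≤o⇒m≤o∸n 2 (≤-trans (length-image-gap v) l)

All-widen⁺ : ∀ {p} {P : Pred ℕ p} {xs} m → All (P ∘ (2 +_)) xs → P 2 → All P (widen m xs)
All-widen⁺ m ps p2 = All.++⁺ (All.map⁺ ps) (All.replicate⁺ m p2)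

image≤top : ∀ {w} → Valid w → All (_≤ top w) (image w)
image≤top []                         = []
image≤top (_∷₁_ {x} {w} l v)         = ≤-refl ∷ All.map (λ y≤ → ≤-trans y≤ (<⇒≤ (low≤⇒top< w l))) (image≤top v)
image≤top (_∷₂_ {x} {w} l v)         =
  All-widen⁺ (x ∸ length (image w)) (All.map (λ y≤ → ≤-trans (s≤s (s≤s y≤)) l) (image≤top v))
    (≤-trans (s≤s (s≤s z≤n)) l)

image-positive : ∀ {w} → Valid w → All (0 <_) (image w)
image-positive []                 = []
image-positive (_∷₁_ {w = w} l v) = ≤-trans (low>0 w) l ∷ image-positive v
image-positive (_∷₂_ {x} {w} l v) =
  All-widen⁺ (x ∸ length (image w)) (All.map (λ _ → s≤s z≤n) (image-positive v)) (s≤s z≤n)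

sum-widen : ∀ m xs → sum (widen m xs) ≡ 2 * (length xs + m) + sum xs
sum-widen m [] = begin
  sum (replicate m 2) ≡⟨ sum-replicate2 m ⟩
  2 * m               ≡⟨ +-identityʳ _ ⟨
  2 * m + 0           ∎
  where
  open ≡-Reasoning
  sum-replicate2 : ∀ m → sum (replicate m 2) ≡ 2 * m
  sum-replicate2 zero    = refl
  sum-replicate2 (suc m) = trans (cong (2 +_) (sum-replicate2 m)) (sym (*-suc 2 m))
sum-widen m (x ∷ xs) = trans (cong (2 + x +_) (sum-widen m xs))
  (solve 3 (λ x k s → con 2 :+ x :+ (con 2 :* k :+ s) := con 2 :* (con 1 :+ k) :+ (x :+ s))
    refl x (length xs + m) (sum xs))
  where open +-*-Solver

-- The two new columns have x cells each and account for the two copies of x.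
sum-image : ∀ {w} → Valid w → sum (image w) ≡ sum (word-parts w)
sum-image []                 = refl
sum-image (_∷₁_ {x} l v)     = cong (x +_) (sum-image v)
sum-image (_∷₂_ {x} {w} l v) = begin
  sum (widen (x ∸ n) (image w))
    ≡⟨ sum-widen (x ∸ n) (image w) ⟩
  2 * (n + (x ∸ n)) + sum (image w)
    ≡⟨ cong₂ (λ a b → 2 * a + b) (m+[n∸m]≡n (length-image≤₂ l v)) (sum-image v) ⟩
  2 * x + sum (word-parts w)
    ≡⟨ solve 2 (λ x s → con 2 :* x :+ s := x :+ (x :+ s)) refl x (sum (word-parts w)) ⟩
  x + (x + sum (word-parts w))           ∎
  where
  open ≡-Reasoning
  open +-*-Solver
  n = length (image w)

-- Injectivity of `image`.

decreasing-∷ : ∀ {x xs} → All (_< x) xs → Linked _>_ xs → Linked _>_ (x ∷ xs)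
decreasing-∷ []        _  = [-]
decreasing-∷ (y<x ∷ _) ls = y<x ∷ ls

image<₁ : ∀ {x w} → low w ≤ x → Valid w → All (_< x) (image w)
image<₁ {x} {w} l v = All.map (λ y≤ → ≤-<-trans y≤ (low≤⇒top< w l)) (image≤top v)

widen-not-decreasing : ∀ m xs → 2 ≤ m → ¬ Linked _>_ (widen m xs)
widen-not-decreasing (suc zero)    []       (s≤s ())
widen-not-decreasing (suc (suc m)) []       2≤m (2>2 ∷ _) = <-irrefl refl 2>2
widen-not-decreasing (suc m)       (x ∷ xs) 2≤m ls        = widen-not-decreasing (suc m) xs 2≤m (Linked.tail ls)

-- A word without repeated parts is its own image; otherwise there is slack
-- in length-image<low.
slack-or-decreasing : ∀ {w} → Valid w → suc (length (image w)) < low w ⊎ Linked _>_ (image w)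
slack-or-decreasing [] = inj₂ []
slack-or-decreasing (l ∷₁ v) with slack-or-decreasing v
... | inj₁ s = inj₁ (s≤s (≤-trans s l))
... | inj₂ d = inj₂ (decreasing-∷ (image<₁ l v) d)
slack-or-decreasing (l ∷₂ v) = inj₁ (s≤s (s≤s (≤-reflexive (length-image₂ l v))))

-- Widened positive rows have length at least 3, so they are told apart from the added rows of
-- length 2 without knowing that m and n agree.
widen-injective : ∀ {m n xs ys} → All (0 <_) xs → All (0 <_) ys → widen m xs ≡ widen n ys → xs ≡ ys
widen-injective [] [] eq = refl
widen-injective {m = suc m} [] (s≤s _ ∷ _) ()
widen-injective {n = suc n} (s≤s _ ∷ _) [] ()
widen-injective (_ ∷ ps) (_ ∷ qs) eq =
  cong₂ _∷_ (+-cancelˡ-≡ 2 _ _ (∷-injectiveˡ eq)) (widen-injective ps qs (∷-injectiveʳ eq))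

-- With slack, the head x on the left exceeds the number of rows, while on the right every part is
-- at most y, the number of rows. Otherwise the left side is strictly decreasing and the right side
-- contains 2 twice.
image₁≢image₂ : ∀ {x w y w′} → Valid (x ∷₁ w) → Valid (y ∷₂ w′) → image (x ∷₁ w) ≢ image (y ∷₂ w′)
image₁≢image₂ {x} {w} {y} {w′} (l ∷₁ v) v₂@(l′ ∷₂ v′) eq with slack-or-decreasing v
... | inj₁ s = <⇒≱ (≤-trans s l) (≤-trans x≤y (≤-reflexive (sym y≡)))
  where
  y≡ : suc (length (image w)) ≡ y
  y≡ = trans (cong length eq) (length-image₂ l′ v′)
  x≤y : x ≤ y
  x≤y = All.head (subst (All (_≤ y)) (sym eq) (image≤top v₂))
... | inj₂ d = widen-not-decreasing _ (image w′) (2≤new-rows l′ v′)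
                 (subst (Linked _>_) eq (decreasing-∷ (image<₁ l v) d))

image₂≢[] : ∀ {y w} → Valid (y ∷₂ w) → image (y ∷₂ w) ≢ []
image₂≢[] (l ∷₂ v) eq = <⇒≢ (≤-trans (s≤s z≤n) l) (trans (cong length (sym eq)) (length-image₂ l v))

image-injective : ∀ {w w′} → Valid w → Valid w′ → image w ≡ image w′ → w ≡ w′
image-injective []             []              eq = refl
image-injective []             v′@(_ ∷₂ _)     eq = contradiction (sym eq) (image₂≢[] v′)
image-injective v@(_ ∷₂ _)     []              eq = contradiction eq (image₂≢[] v)
image-injective (_ ∷₁ v)       (_ ∷₁ v′)       eq =
  cong₂ _∷₁_ (∷-injectiveˡ eq) (image-injective v v′ (∷-injectiveʳ eq))
image-injective v@(_ ∷₁ _)     v′@(_ ∷₂ _)     eq = contradiction eq (image₁≢image₂ v v′)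
image-injective v@(_ ∷₂ _)     v′@(_ ∷₁ _)     eq = contradiction (sym eq) (image₁≢image₂ v′ v)
-- The number of rows recovers the doubled top.
image-injective (l ∷₂ v)       (l′ ∷₂ v′)      eq =
  cong₂ _∷₂_ (trans (sym (length-image₂ l v)) (trans (cong length eq) (length-image₂ l′ v′)))
             (image-injective v v′ (widen-injective (image-positive v) (image-positive v′) eq))

-- Ladders and the range of `image`.

-- 𝒜₂ with largest repeated part r, presented by adding pairs of columns to
-- partitions into distinct parts.
data Ladder : ℕ → List ℕ → Set where
  distinct : ∀ {xs} → Linked _>_ xs → All (0 <_) xs → Ladder 0 xs
  step     : ∀ {r xs m} → Ladder r xs → 2 ≤ m → Ladder (2 + r) (widen m xs)

unshift : ∀ x xs → All (_< suc (suc x)) (List.map (2 +_) xs) → All (_< x) xs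
unshift x xs as = All.map (s≤s⁻¹ ∘ s≤s⁻¹) (All.map⁻ as)

-- A head above all parts exceeds the added 2s, so it is itself a widened row, of positive length x
-- - 2, and can be inserted before the widening.
Ladder-∷ : ∀ {r x xs} → Ladder r xs → 0 < x → All (_< x) xs → Ladder r (x ∷ xs)
Ladder-∷ (distinct dec pos) 0<x as = distinct (decreasing-∷ as dec) (0<x ∷ pos)
Ladder-∷ {x = x} (step {xs = xs} {m = suc m} L 2≤m) 0<x as with x | All.++⁻ (List.map (2 +_) xs) as
... | suc (suc x) | bs , s≤s (s≤s 0<x) ∷ _ = step (Ladder-∷ L 0<x (unshift x xs bs)) 2≤m
... | suc zero    | _ , s≤s () ∷ _

image-Ladder : ∀ {w} → Valid w → ∃ λ r → Ladder r (image w)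
image-Ladder []                 = 0 , distinct [] []
image-Ladder (_∷₁_ {w = w} l v) with image-Ladder v
... | r , L = r , Ladder-∷ L (≤-trans (low>0 w) l) (image<₁ l v)
image-Ladder (l ∷₂ v) with image-Ladder v
... | r , L = 2 + r , step L (2≤new-rows l v)

decreasing-head : ∀ {x xs} → Linked _>_ (x ∷ xs) → All (_< x) xs
decreasing-head [-]        = []
decreasing-head (y<x ∷ ls) = y<x ∷ All.map (λ z<y → <-trans z<y y<x) (decreasing-head ls)

-- Widening lengthens the head by 2 but adds m ≥ 2 rows, so a head exceeding the number of rows did
-- so before.
rows<head : ∀ m {x} xs → 2 ≤ m → length (widen m (x ∷ xs)) < 2 + x → length (x ∷ xs) < x
rows<head m {x} xs 2≤m short = s≤s⁻¹ (s≤s⁻¹ (begin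
  4 + length xs                ≡⟨ cong (2 +_) (+-comm 2 (length xs)) ⟩
  2 + (length xs + 2)          ≤⟨ s≤s (s≤s (+-monoʳ-≤ (length xs) 2≤m)) ⟩
  2 + (length xs + m)          ≡⟨ cong suc (length-widen m (x ∷ xs)) ⟨
  suc (length (widen m (x ∷ xs))) ≤⟨ short ⟩
  2 + x                        ∎))
  where open ≤-Reasoning

-- Each of the r/2 even numbers up to r occurs twice, so there are at least r
-- rows, and a head exceeding the number of rows lies above all repeated parts.
Ladder-uncons : ∀ {r x xs} → Ladder r (x ∷ xs) → length (x ∷ xs) < x → Ladder r xs × All (_< x) xs
Ladder-uncons L = go L refl
  where
  go : ∀ {r x xs ys} → Ladder r ys → ys ≡ x ∷ xs → length ys < x → Ladder r xs × All (_< x) xs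
  go (distinct dec pos) refl _ = distinct (Linked.tail dec) (All.tail pos) , decreasing-head dec
  go (step {xs = []} {m = suc zero} L (s≤s ())) _ _
  go (step {xs = []} {m = suc (suc m)} L 2≤m) refl l = contradiction l (≤⇒≯ (s≤s (s≤s z≤n)))
  go (step {xs = z ∷ zs} {m = m} L 2≤m) refl l =
    let L′ , below = go L refl (rows<head m zs 2≤m l)
    in step L′ 2≤m , All-widen⁺ m (All.map (s≤s ∘ s≤s) below)
                      (s≤s (s≤s (≤-trans (s≤s z≤n) (rows<head m zs 2≤m l))))

Preimage : List ℕ → Set
Preimage xs = ∃ λ w → Valid w × image w ≡ xs

distinct-preimage : ∀ {xs} → Linked _>_ xs → All (0 <_) xs → Preimage xs
distinct-preimage {[]}         _          _          = [] , [] , refl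
distinct-preimage {x ∷ []}     _          (0<x ∷ _)  = x ∷₁ [] , 0<x ∷₁ [] , refl
distinct-preimage {x ∷ y ∷ ys} (y<x ∷ ls) (0<x ∷ ps) with distinct-preimage ls ps
... | z ∷₁ w , v , refl = x ∷₁ z ∷₁ w , y<x ∷₁ v , refl
-- The image of a word with doubled top contains 2 at least twice, hence is not strictly decreasing.
... | z ∷₂ w , v@(l ∷₂ v′) , eq =
  contradiction (subst (Linked _>_) (sym eq) ls) (widen-not-decreasing _ (image w) (2≤new-rows l v′))

mutual

  Ladder-preimage : ∀ {r xs} → Ladder r xs → Preimage xs
  Ladder-preimage (distinct dec pos)      = distinct-preimage dec pos
  Ladder-preimage (step {xs = xs} L 2≤m) = widen-preimage xs L 2≤m

  -- Comparing the head 2 + y with the number of rows decides which constructor came last. Peeling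
  -- off a pair of columns lowers r by 2; removing a head keeps r and shortens the list, so the
  -- recursion ends.
  widen-preimage : ∀ {r m} xs → Ladder r xs → 2 ≤ m → Preimage (widen m xs)
  widen-preimage {m = m} [] L 2≤m = m ∷₂ [] , 2≤m ∷₂ [] , refl
  widen-preimage {m = m} (y ∷ ys) L 2≤m with 2 + y ≤? length (widen m (y ∷ ys))
  ... | yes y+2≤n = twice (Ladder-preimage L)
    where
    n = length (widen m (y ∷ ys))
    n≡ : n ≡ length (y ∷ ys) + m
    n≡ = length-widen m (y ∷ ys)
    -- A single top of w is y itself. A doubled top is the number of rows before widening, which n
    -- exceeds by m ≥ 2.
    fits : ∀ {w} → Valid w → image w ≡ y ∷ ys → 2 + top w ≤ n
    fits (_ ∷₁ _) refl = y+2≤n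
    fits v@(_∷₂_ {z} {w} l v′) eq = begin
      2 + z                     ≡⟨ cong (2 +_) (trans (sym (length-image₂ l v′)) (cong length eq)) ⟩
      2 + length (y ∷ ys)       ≡⟨ +-comm 2 _ ⟩
      length (y ∷ ys) + 2       ≤⟨ +-monoʳ-≤ (length (y ∷ ys)) 2≤m ⟩
      length (y ∷ ys) + m       ≡⟨ n≡ ⟨
      n                         ∎
      where open ≤-Reasoning
    twice : Preimage (y ∷ ys) → Preimage (widen m (y ∷ ys))
    twice (w , v , eq) = n ∷₂ w , fits v eq ∷₂ v , cong₂ widen
      (trans (cong₂ _∸_ n≡ (cong length eq)) (m+n∸m≡n (length (y ∷ ys)) m)) eq
  ... | no y+2≰n = once (widen-preimage ys L′ 2≤m)
    where
    n<y+2 = ≰⇒> y+2≰n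
    tail = Ladder-uncons (step L 2≤m) n<y+2
    L′ = proj₁ (Ladder-uncons L (rows<head m ys 2≤m n<y+2))
    fits : ∀ {w} → Valid w → image w ≡ widen m ys → low w ≤ 2 + y
    fits [] _ = s≤s z≤n
    fits (_ ∷₁ _) eq = All.head (subst (All (_< 2 + y)) (sym eq) (proj₂ tail))
    -- Here z is the number of rows left after removing the head, one less than n, so 2 + z is n +
    -- 1, at most 2 + y.
    fits (_∷₂_ {z} l v) eq =
      ≤-trans (s≤s (s≤s (≤-reflexive (trans (sym (length-image₂ l v)) (cong length eq))))) n<y+2
    once : Preimage (widen m ys) → Preimage (widen m (y ∷ ys))
    once (w , v , eq) = (2 + y) ∷₁ w , fits v eq ∷₁ v , cong (2 + y ∷_) eq

-- The definition of `f` evaluated on words.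

doubles : Word → List ℕ
doubles []       = []
doubles (x ∷₁ w) = doubles w
doubles (x ∷₂ w) = x ∷ doubles w

-- The block π^(k): the single parts met after exactly k doubled ones, reading from the top.
segment : Word → ℕ → List ℕ
segment []       _       = []
segment (x ∷₁ w) zero    = x ∷ segment w zero
segment (x ∷₁ w) (suc k) = segment w (suc k)
segment (x ∷₂ w) zero    = []
segment (x ∷₂ w) (suc k) = segment w k

filter-cong-local : ∀ {A : Set} {p q} {P : Pred A p} {Q : Pred A q}
                    (P? : Decidable P) (Q? : Decidable Q) {xs} →
                    All (λ x → P x ⇔ Q x) xs → filter P? xs ≡ filter Q? xs
filter-cong-local P? Q? [] = refl
filter-cong-local P? Q? {x ∷ xs} (p⇔q ∷ eqs) with P? x | filter-cong-local P? Q? eqs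
... | yes p | eq = trans (cong (x ∷_) eq) (sym (filter-accept Q? (Equivalence.to p⇔q p)))
... | no ¬p | eq = trans eq (sym (filter-reject Q? (¬p ∘ Equivalence.from p⇔q)))

doubles≤top : ∀ {w} → Valid w → All (_≤ top w) (doubles w)
doubles≤top []                        = []
doubles≤top (_∷₁_ {x} {w} l v)        = All.map (λ y≤ → ≤-trans y≤ (<⇒≤ (low≤⇒top< w l))) (doubles≤top v)
doubles≤top (_∷₂_ {x} {w} l v)        = ≤-refl ∷ All.map (λ y≤ → ≤-trans y≤ (<⇒≤ (2+top≤⇒top< w l))) (doubles≤top v)

nthOr0≤ : ∀ {n xs} → All (_≤ n) xs → ∀ i → nthOr0 xs i ≤ n
nthOr0≤ []       i       = z≤n
nthOr0≤ (p ∷ ps) zero    = p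
nthOr0≤ (p ∷ ps) (suc i) = nthOr0≤ ps i

repeated-in : (xs : List ℕ) → List ℕ → List ℕ
repeated-in xs = filter (λ j → count j xs ≟ 2)

-- Multiplicities are taken in the whole list; a new top x does not change those of the parts below
-- it.
repeated-in-irrelevant : ∀ {x} ys zs → All (_< x) zs → (∀ {j} → j ≢ x → count j ys ≡ count j zs) →
                         repeated-in ys zs ≡ repeated-in zs zs
repeated-in-irrelevant ys zs zs<x eq =
  filter-cong-local (λ j → count j ys ≟ 2) (λ j → count j zs ≟ 2)
    (All.map (λ j<x → mk⇔ (trans (sym (eq (<⇒≢ j<x)))) (trans (eq (<⇒≢ j<x)))) zs<x)

doubles-correct : ∀ {w} → Valid w → deduplicate _≟_ (repeated-in (word-parts w) (word-parts w)) ≡ doubles w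
doubles-correct []  = refl
doubles-correct (_∷₁_ {x} {w} l v) = begin
  deduplicate _≟_ (repeated-in (x ∷ ws) (x ∷ ws))
    ≡⟨ cong (deduplicate _≟_) (filter-reject (λ j → count j (x ∷ ws) ≟ 2) {x = x} {xs = ws} once) ⟩
  deduplicate _≟_ (repeated-in (x ∷ ws) ws)
    ≡⟨ cong (deduplicate _≟_) (repeated-in-irrelevant (x ∷ ws) ws (parts<₁ l v) (count-there _ ws)) ⟩
  deduplicate _≟_ (repeated-in ws ws)
    ≡⟨ doubles-correct v ⟩
  doubles w ∎
  where
  open ≡-Reasoning
  ws = word-parts w
  once : count x (x ∷ ws) ≢ 2
  once eq = contradiction (trans (sym eq) (trans (count-here x ws) (cong suc (count-above x (parts<₁ l v))))) λ ()
doubles-correct (_∷₂_ {x} {w} l v) = begin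
  deduplicate _≟_ (repeated-in xxs xxs)
    ≡⟨ cong (deduplicate _≟_) (trans (filter-accept P? {xs = x ∷ ws} twice)
                                      (cong (x ∷_) (filter-accept P? {xs = ws} twice))) ⟩
  deduplicate _≟_ (x ∷ x ∷ repeated-in xxs ws)
    ≡⟨ cong (λ ys → deduplicate _≟_ (x ∷ x ∷ ys)) (repeated-in-irrelevant xxs ws (parts<₂ l v)
             λ j≢x → trans (count-there _ (x ∷ ws) j≢x) (count-there _ ws j≢x)) ⟩
  deduplicate _≟_ (x ∷ x ∷ repeated-in ws ws)
    -- `deduplicate` keeps the first x and filters the rest, once for each of the two copies.
    ≡⟨ cong (λ ys → x ∷ filter x≢? (x ∷ filter x≢? ys)) (doubles-correct v) ⟩
  x ∷ filter x≢? (x ∷ filter x≢? (doubles w))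
    ≡⟨ cong (x ∷_) (filter-reject x≢? (λ x≢x → x≢x refl)) ⟩
  x ∷ filter x≢? (filter x≢? (doubles w))
    ≡⟨ cong (x ∷_) (trans (cong (filter x≢?) same) same) ⟩
  x ∷ doubles w ∎
  where
  open ≡-Reasoning
  ws = word-parts w
  xxs = x ∷ x ∷ ws
  P? = λ j → count j xxs ≟ 2
  x≢? = ¬? ∘ (x ≟_)
  twice : count x xxs ≡ 2
  twice = trans (count-twice x ws) (cong (2 +_) (count-above x (parts<₂ l v)))
  same : filter x≢? (doubles w) ≡ doubles w
  same = filter-all x≢? (All.map (λ y≤ x≡y → <⇒≢ (≤-<-trans y≤ (2+top≤⇒top< w l)) (sym x≡y)) (doubles≤top v))

open Supremum _<_ using (_<⁺_; <⁺-dec; [_]; [_]<⊤⁺; [<]-injective)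

-- The sequence of the R_k as a function of the list of doubled parts alone, so that the recursion
-- on words can replace that list.
bound : List ℕ → ℕ → ℕ ⁺
bound ds zero    = ⊤⁺
bound ds (suc i) = [ nthOr0 ds i ]

Between : List ℕ → ℕ → ℕ → Set
Between ds k j = bound ds (suc k) <⁺ [ j ] × [ j ] <⁺ bound ds k

between? : ∀ ds k → Decidable (Between ds k)
between? ds k j = <⁺-dec _<?_ (bound ds (suc k)) [ j ] ×-dec <⁺-dec _<?_ [ j ] (bound ds k)

segment-correct : ∀ {w} → Valid w → ∀ k → filter (between? (doubles w) k) (word-parts w) ≡ segment w k
segment-correct [] k = refl
segment-correct (_∷₁_ {x} {w} l v) zero =
  trans (filter-accept (between? (doubles w) zero)
          ([ ≤-<-trans (nthOr0≤ (doubles≤top v) 0) (low≤⇒top< w l) ] , [ x ]<⊤⁺))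
        (cong (x ∷_) (segment-correct v zero))
segment-correct (_∷₁_ {x} {w} l v) (suc k) =
  trans (filter-reject (between? (doubles w) (suc k))
          λ (_ , x<) → <⇒≱ (≤-<-trans (nthOr0≤ (doubles≤top v) k) (low≤⇒top< w l)) (<⇒≤ ([<]-injective x<)))
        (segment-correct v (suc k))
segment-correct v₀@(_∷₂_ {x} {w} l v) zero =
  filter-none (between? (x ∷ doubles w) zero)
    (All.map (λ y≤x (x<y , _) → <⇒≱ ([<]-injective x<y) y≤x) (parts≤top v₀))
segment-correct (_∷₂_ {x} {w} l v) (suc k) =
  trans (trans (filter-reject P? (x∉ k)) (filter-reject P? (x∉ k)))
    (trans (filter-cong-local P? (between? (doubles w) k) (All.map (same k) (parts<₂ l v))) (segment-correct v k))
  where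
  P? = between? (x ∷ doubles w) (suc k)
  x∉ : ∀ k → ¬ Between (x ∷ doubles w) (suc k) x
  x∉ zero    (_ , x<x) = <-irrefl refl ([<]-injective x<x)
  x∉ (suc k) (_ , x<)  = <⇒≱ (≤-<-trans (nthOr0≤ (doubles≤top v) k) (2+top≤⇒top< w l)) (<⇒≤ ([<]-injective x<))
  same : ∀ k {y} → y < x → Between (x ∷ doubles w) (suc k) y ⇔ Between (doubles w) k y
  -- The upper bound x takes the place of R_0 = ∞, which makes no difference below x.
  same zero    y<x = mk⇔ (λ (a , _) → a , [ _ ]<⊤⁺) (λ (a , _) → a , [ y<x ])
  same (suc k) y<x = mk⇔ id id

-- The two unions in the definition of f, as functions of the list of the R_i
-- (i ≥ 1) and of the sequence of the π^(i).
new-parts : List ℕ → (ℕ → List ℕ) → List ℕ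
new-parts ds b =
  concat (applyUpTo (λ i → replicate (nthOr0 ds i ∸ nthOr0 ds (suc i) ∸ length (b (suc i))) (2 * suc i))
                    (length ds))

shifted-blocks : ℕ → (ℕ → List ℕ) → List ℕ
shifted-blocks n b = concat (applyUpTo (λ i → List.map (_+ 2 * i) (b i)) n)

applyUpTo-cong : ∀ {A : Set} {g h : ℕ → A} → (∀ i → g i ≡ h i) → ∀ n → applyUpTo g n ≡ applyUpTo h n
applyUpTo-cong eq zero    = refl
applyUpTo-cong eq (suc n) = cong₂ _∷_ (eq 0) (applyUpTo-cong (eq ∘ suc) n)

map-concat-applyUpTo : ∀ {A B : Set} (h : A → B) (g : ℕ → List A) n →
                       concat (applyUpTo (List.map h ∘ g) n) ≡ List.map h (concat (applyUpTo g n))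
map-concat-applyUpTo h g n = trans (cong concat (sym (map-applyUpTo g (List.map h) n))) (concat-map (applyUpTo g n))

-- The largest doubled part R_1 accounts for R_1 rows (none if it is absent), and each single part
-- above it for one more. This turns the exponents in `f` into numbers of new rows.
length-image : ∀ {w} → Valid w → length (image w) ≡ nthOr0 (doubles w) 0 + length (segment w 0)
length-image []                 = refl
length-image (_∷₁_ {x} {w} l v) = trans (cong suc (length-image v)) (sym (+-suc (nthOr0 (doubles w) 0) _))
length-image (l ∷₂ v)           = trans (length-image₂ l v) (sym (+-identityʳ _))

-- A doubled top raises every index by one, which adds 2 to all parts obtained so far; the new term
-- i = 1 of the first union supplies the parts 2, and the new block 0 is empty.
image-↭ : ∀ {w} → Valid w →
          new-parts (doubles w) (segment w) ++ shifted-blocks (suc (length (doubles w))) (segment w) ↭ image w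
image-↭ []  = ↭-refl
image-↭ (_∷₁_ {x} {w} l v) = begin
  F ++ (x + 0) ∷ G  ↭⟨ Perm.shift (x + 0) F G ⟩
  (x + 0) ∷ F ++ G  ≡⟨ cong (_∷ F ++ G) (+-identityʳ x) ⟩
  x ∷ F ++ G        ↭⟨ prep x (image-↭ v) ⟩
  x ∷ image w       ∎
  where
  open PermutationReasoning
  F = new-parts (doubles w) (segment w)
  G = shifted-blocks (suc (length (doubles w))) (segment w)
image-↭ (_∷₂_ {x} {w} l v) = begin
  (replicate k′ 2 ++ F′) ++ G′
    ≡⟨ cong₂ (λ a b → (replicate k′ 2 ++ a) ++ b) F′≡ G′≡ ⟩
  (replicate k′ 2 ++ List.map (2 +_) F) ++ List.map (2 +_) G
    ≡⟨ ++-assoc (replicate k′ 2) _ _ ⟩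
  replicate k′ 2 ++ List.map (2 +_) F ++ List.map (2 +_) G
    ≡⟨ cong₂ _++_ (cong (λ n → replicate n 2) k′≡k) (sym (map-++ (2 +_) F G)) ⟩
  replicate k 2 ++ List.map (2 +_) (F ++ G)
    ↭⟨ Perm.++⁺ˡ (replicate k 2) (Perm.map⁺ (2 +_) (image-↭ v)) ⟩
  replicate k 2 ++ List.map (2 +_) (image w)
    ↭⟨ Perm.++-comm (replicate k 2) _ ⟩
  List.map (2 +_) (image w) ++ replicate k 2               ∎
  where
  open PermutationReasoning
  ds = doubles w
  b  = segment w
  F = new-parts ds b
  G = shifted-blocks (suc (length ds)) b
  k = x ∸ length (image w)
  k′ = x ∸ nthOr0 ds 0 ∸ length (b 0)
  k′≡k : k′ ≡ k
  k′≡k = trans (∸-+-assoc x (nthOr0 ds 0) _) (cong (x ∸_) (sym (length-image v)))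
  g = λ i → replicate (nthOr0 ds i ∸ nthOr0 ds (suc i) ∸ length (b (suc i))) (2 * suc i)
  F′ = concat (applyUpTo (λ i → replicate (nthOr0 ds i ∸ nthOr0 ds (suc i) ∸ length (b (suc i))) (2 * suc (suc i)))
                         (length ds))
  F′≡ : F′ ≡ List.map (2 +_) F
  F′≡ = trans (cong concat (applyUpTo-cong
                (λ i → trans (cong (replicate _) (*-suc 2 (suc i))) (sym (map-replicate (2 +_) _ (2 * suc i))))
                (length ds)))
              (map-concat-applyUpTo (2 +_) g (length ds))
  h = λ i → List.map (_+ 2 * i) (b i)
  G′ = concat (applyUpTo (λ i → List.map (_+ 2 * suc i) (b i)) (suc (length ds)))
  shift-eq : ∀ i y → y + 2 * suc i ≡ 2 + (y + 2 * i)
  shift-eq i y = solve 2 (λ i y → y :+ con 2 :* (con 1 :+ i) := con 2 :+ (y :+ con 2 :* i)) refl i y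
    where open +-*-Solver
  G′≡ : G′ ≡ List.map (2 +_) G
  G′≡ = trans (cong concat (applyUpTo-cong
                (λ i → trans (map-cong (shift-eq i) (b i)) (map-∘ {g = 2 +_} {f = _+ 2 * i} (b i)))
                (suc (length ds))))
              (map-concat-applyUpTo (2 +_) h (suc (length ds)))

doubledParts-word : ∀ {w} → Valid w → ∀ π → word-parts w ≡ parts π → doubledParts π ≡ doubles w
doubledParts-word v (mkPartition _ _ _) refl = doubles-correct v

block-between : ∀ π k → parts (block π k) ≡ filter (between? (doubledParts π) k) (parts π)
block-between π zero    = refl
block-between π (suc k) = refl

block-word : ∀ {w} → Valid w → ∀ π → word-parts w ≡ parts π → ∀ k → parts (block π k) ≡ segment w k
block-word {w} v π eq k = begin
  parts (block π k)                                  ≡⟨ block-between π k ⟩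
  filter (between? (doubledParts π) k) (parts π)
    ≡⟨ cong₂ (λ ds → filter (between? ds k)) (doubledParts-word v π eq) (sym eq) ⟩
  filter (between? (doubles w) k) (word-parts w)     ≡⟨ segment-correct v k ⟩
  segment w k                                        ∎
  where open ≡-Reasoning

parts-⋃ : ∀ πs → parts (⋃ πs) ↭ concat (List.map parts πs)
parts-⋃ []       = ↭-refl
parts-⋃ (π ∷ πs) = ↭-trans (Perm.merge-↭ _≥?_ (parts π) (parts (⋃ πs))) (Perm.++⁺ˡ (parts π) (parts-⋃ πs))

parts-f : ∀ {w} → Valid w → ∀ π → word-parts w ≡ parts π → parts (f π) ↭ image w
parts-f {w} v π eq = begin
  parts (f π)
    ↭⟨ Perm.merge-↭ _≥?_ (parts (⋃ (applyUpTo g (D π)))) (parts (⋃ (applyUpTo h (suc (D π))))) ⟩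
  parts (⋃ (applyUpTo g (D π))) ++ parts (⋃ (applyUpTo h (suc (D π))))
    ↭⟨ Perm.++⁺ (parts-⋃ (applyUpTo g (D π))) (parts-⋃ (applyUpTo h (suc (D π)))) ⟩
  concat (List.map parts (applyUpTo g (D π))) ++ concat (List.map parts (applyUpTo h (suc (D π))))
    ≡⟨ cong₂ (λ s t → concat s ++ concat t) (map-applyUpTo g parts (D π)) (map-applyUpTo h parts (suc (D π))) ⟩
  new-parts (doubledParts π) b ++ shifted-blocks (suc (D π)) b
    ≡⟨ cong (λ ds → new-parts ds b ++ shifted-blocks (suc (length ds)) b) (doubledParts-word v π eq) ⟩
  new-parts ds b ++ shifted-blocks (suc (length ds)) b
    ≡⟨ cong₂ (λ s t → concat s ++ concat t)
             (applyUpTo-cong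
               (λ i → cong (λ c → replicate (nthOr0 ds i ∸ nthOr0 ds (suc i) ∸ length c) (2 * suc i))
                           (block-word v π eq (suc i)))
               (length ds))
             (applyUpTo-cong (λ i → cong (List.map (_+ 2 * i)) (block-word v π eq i)) (suc (length ds))) ⟩
  new-parts ds (segment w) ++ shifted-blocks (suc (length ds)) (segment w)
    ↭⟨ image-↭ v ⟩
  image w ∎
  where
  open PermutationReasoning
  b  = parts ∘ block π
  ds = doubles w
  g  = λ i → ⟨ 2 * suc i ^ R₁₊ π i ∸ R₁₊ π (suc i) ∸ ℓ (block π (suc i)) ⟩
  h  = λ i → addToEachPart (2 * i) (block π i)

-- Multiplicities in ladders and the equivalence with `𝒜₂`.

count-++ : ∀ j xs ys → count j (xs ++ ys) ≡ count j xs + count j ys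
count-++ j xs ys = trans (cong length (filter-++ (j ≟_) xs ys)) (length-++ (filter (j ≟_) xs))

count-replicate : ∀ j m → count j (replicate m j) ≡ m
count-replicate j zero    = refl
count-replicate j (suc m) = trans (count-here j _) (cong suc (count-replicate j m))

count-shift : ∀ j xs → count (2 + j) (List.map (2 +_) xs) ≡ count j xs
count-shift j []       = refl
count-shift j (x ∷ xs) with j ≟ x
... | yes refl = trans (count-here (2 + j) _) (trans (cong suc (count-shift j xs)) (sym (count-here j xs)))
... | no  j≢x  = trans (count-there (2 + j) _ (j≢x ∘ suc-injective ∘ suc-injective))
                       (trans (count-shift j xs) (sym (count-there j xs j≢x)))

count-widen-< : ∀ {j} m xs → j < 2 → count j (widen m xs) ≡ 0
count-widen-< {j} m xs j<2 = count-none j (All-widen⁺ {xs = xs} m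
  (All.tabulate λ _ j≡ → <⇒≱ j<2 (≤-trans (s≤s (s≤s z≤n)) (≤-reflexive (sym j≡)))) (<⇒≢ j<2))

count-widen-2 : ∀ m xs → count 2 (widen m xs) ≡ count 0 xs + m
count-widen-2 m xs = trans (count-++ 2 (List.map (2 +_) xs) _) (cong₂ _+_ (count-shift 0 xs) (count-replicate 2 m))

count-widen : ∀ {j} m xs → 0 < j → count (2 + j) (widen m xs) ≡ count j xs
count-widen {suc j} m xs _ = trans (count-++ (3 + j) (List.map (2 +_) xs) _)
  (trans (cong₂ _+_ (count-shift (suc j) xs) (count-none (3 + j) (All.replicate⁺ m λ ()))) (+-identityʳ _))

∣-shift : ∀ {j} → 2 ∣ j → 2 ∣ 2 + j
∣-shift = ∣m∣n⇒∣m+n ∣-refl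

∣-unshift : ∀ {j} → 2 ∣ 2 + j → 2 ∣ j
∣-unshift 2∣ = ∣m+n∣m⇒∣n 2∣ ∣-refl

-- The conditions of `𝒜₂` with r free. Including j = r among the repeated even parts and bounding
-- everything above r makes an even r the largest repeated part.
record Profile (r : ℕ) (xs : List ℕ) : Set where
  field
    odd-below  : ∀ j → 2 ∤ j → j < r → count j xs ≡ 0
    even-below : ∀ j → 2 ∣ j → 0 < j → j ≤ r → 2 ≤ count j xs
    above      : ∀ j → r < j → count j xs ≤ 1

open Profile

decreasing-count : ∀ {xs} → Linked _>_ xs → ∀ j → count j xs ≤ 1
decreasing-count {[]}     ls j = z≤n
decreasing-count {x ∷ xs} ls j with j ≟ x
... | yes refl = ≤-reflexive (trans (count-here j xs) (cong suc (count-above j (decreasing-head ls))))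
... | no  j≢x  = ≤-trans (≤-reflexive (count-there j xs j≢x)) (decreasing-count (Linked.tail ls) j)

-- Widening moves multiplicities of positive parts up by 2, leaves no part 1 and makes 2 repeated.
Ladder-Profile : ∀ {r xs} → Ladder r xs → Profile r xs
Ladder-Profile (distinct dec pos) = record
  { odd-below  = λ _ _ ()
  ; even-below = λ _ _ 0<j j≤0 → contradiction j≤0 (<⇒≱ 0<j)
  ; above      = λ j _ → decreasing-count dec j
  }
Ladder-Profile (step {r} {xs} {m} L 2≤m) = record { odd-below = odd ; even-below = even ; above = ab }
  where
  P = Ladder-Profile L
  odd : ∀ j → 2 ∤ j → j < 2 + r → count j (widen m xs) ≡ 0
  odd 0 2∤ _ = contradiction (2 ∣0) 2∤
  odd 1 _  _ = count-widen-< m xs (s≤s (s≤s z≤n))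
  odd 2 2∤ _ = contradiction ∣-refl 2∤
  odd (suc (suc j@(suc _))) 2∤ (s≤s (s≤s j<r)) = trans (count-widen m xs (s≤s z≤n)) (odd-below P j (2∤ ∘ ∣-shift) j<r)
  even : ∀ j → 2 ∣ j → 0 < j → j ≤ 2 + r → 2 ≤ count j (widen m xs)
  even 1 2∣1 _ _ = contradiction (∣1⇒≡1 2∣1) λ ()
  even 2 _   _ _ = ≤-trans 2≤m (≤-trans (m≤n+m m _) (≤-reflexive (sym (count-widen-2 m xs))))
  even (suc (suc j@(suc _))) 2∣ _ (s≤s (s≤s j≤r)) =
    ≤-trans (even-below P j (∣-unshift 2∣) (s≤s z≤n) j≤r) (≤-reflexive (sym (count-widen m xs (s≤s z≤n))))
  ab : ∀ j → 2 + r < j → count j (widen m xs) ≤ 1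
  ab (suc (suc j@(suc _))) (s≤s (s≤s r<j)) = ≤-trans (≤-reflexive (count-widen m xs (s≤s z≤n))) (above P j r<j)

Ladder-even : ∀ {r xs} → Ladder r xs → 2 ∣ r
Ladder-even (distinct _ _) = 2 ∣0
Ladder-even (step L _)     = ∣-shift (Ladder-even L)

-- Subtracting 2 from each part sends exactly the 2s to zero; in nonincreasing order they form the
-- end of the list, and m counts them.
unwiden : ∀ {xs} → Linked _≥_ xs → All (2 ≤_) xs →
          ∃ λ m → ∃ λ ys → widen m ys ≡ xs × Linked _≥_ ys × All (0 <_) ys
unwiden {[]} _ _ = 0 , [] , refl , [] , []
unwiden {1 ∷ xs} _ (s≤s () ∷ _)
unwiden {suc (suc x) ∷ xs} ls (_ ∷ ps) with unwiden (Linked.tail ls) ps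
unwiden {2 ∷ xs} ls _ | m , [] , refl , _ , _ = suc m , [] , refl , [] , []
unwiden {2 ∷ xs} ls _ | m , y ∷ ys , refl , _ , 0<y ∷ _ =
  contradiction (Linked.head ls) (<⇒≱ (s≤s (s≤s 0<y)))
unwiden {suc (suc x@(suc _)) ∷ xs} ls _ | m , [] , refl , _ , _ = m , x ∷ [] , refl , [-] , s≤s z≤n ∷ []
unwiden {suc (suc x@(suc _)) ∷ xs} ls _ | m , y ∷ ys , refl , ls′ , ps′ =
  m , x ∷ y ∷ ys , refl , s≤s⁻¹ (s≤s⁻¹ (Linked.head ls)) ∷ ls′ , s≤s z≤n ∷ ps′

count-all-≤1 : ∀ {xs} → Linked _≥_ xs → All (0 <_) xs → (∀ j → 0 < j → count j xs ≤ 1) → Linked _>_ xs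
count-all-≤1 []  _ _ = []
count-all-≤1 [-] _ _ = [-]
count-all-≤1 {x ∷ y ∷ ys} (y≤x ∷ ls) (0<x ∷ ps) c =
  ≤∧≢⇒< y≤x y≢x ∷ count-all-≤1 ls ps λ j 0<j → ≤-trans (count-∷-≤ j x (y ∷ ys)) (c j 0<j)
  where
  y≢x : y ≢ x
  y≢x refl = <⇒≱ (≤-trans (m≤m+n 2 _) (≤-reflexive (sym (count-twice x ys)))) (c x 0<x)

-- For r ≥ 2 the odd part 1 is absent, so two columns can be removed, and the number m of 2s is at
-- least 2 because 2 is an even part up to r. For r = 0 all parts are distinct.
Profile-Ladder : ∀ r {xs} → 2 ∣ r → Linked _≥_ xs → All (0 <_) xs → Profile r xs → Ladder r xs
Profile-Ladder 0 _ ls ps P = distinct (count-all-≤1 ls ps (above P)) ps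
Profile-Ladder 1 2∣1 _ _ _ = contradiction (∣1⇒≡1 2∣1) λ ()
Profile-Ladder (suc (suc r)) {xs} 2∣r ls ps P with unwiden ls (All.tabulate 2≤)
  where
  2≤ : ∀ {x} → x ∈ xs → 2 ≤ x
  2≤ {x} x∈ = ≤∧≢⇒< (All.lookup ps x∈)
    λ { refl → <⇒≱ (count-∈ 1 x∈) (≤-reflexive (odd-below P 1 2∤1 (s≤s (s≤s z≤n)))) }
    where
    2∤1 : 2 ∤ 1
    2∤1 2∣1 = contradiction (∣1⇒≡1 2∣1) λ ()
... | m , ys , refl , ls′ , ps′ = step (Profile-Ladder r (∣-unshift 2∣r) ls′ ps′ P′) 2≤m
  where
  no-zero : count 0 ys ≡ 0
  no-zero = count-none 0 (All.map <⇒≢ ps′)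
  2≤m : 2 ≤ m
  2≤m = ≤-trans (even-below P 2 ∣-refl (s≤s z≤n) (s≤s (s≤s z≤n)))
          (≤-reflexive (trans (count-widen-2 m ys) (cong (_+ m) no-zero)))
  P′ : Profile r ys
  P′ = record
    { odd-below  = λ { zero    2∤j j<r → contradiction (2 ∣0) 2∤j
                     ; j@(suc _) 2∤j j<r → trans (sym (count-widen m ys (s≤s z≤n)))
                         (odd-below P (2 + j) (2∤j ∘ ∣-unshift) (s≤s (s≤s j<r))) }
    ; even-below = λ j 2∣j 0<j j≤r →
        ≤-trans (even-below P (2 + j) (∣-shift 2∣j) (s≤s z≤n) (s≤s (s≤s j≤r)))
                (≤-reflexive (count-widen m ys 0<j))
    ; above      = λ j r<j →
        ≤-trans (≤-reflexive (sym (count-widen m ys (≤-trans (s≤s z≤n) r<j))))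
                (above P (2 + j) (s≤s (s≤s r<j)))
    }

count-⇒∈ : ∀ {j} xs → 1 ≤ count j xs → j ∈ xs
count-⇒∈ {j} (x ∷ xs) c with j ≟ x
... | yes refl = here refl
... | no  j≢x  = there (count-⇒∈ xs (≤-trans c (≤-reflexive (count-there j xs j≢x))))

module _ (π : Partition) where

  private
    repeated? = λ j → 2 ≤? mult j π

  repeated≤largest : ∀ {j} → 2 ≤ mult j π → j ≤ largestRepeated π
  repeated≤largest {j} 2≤ = All.lookup (xs≤max 0 (filter repeated? (parts π)))
    (∈-filter⁺ repeated? (count-⇒∈ (parts π) (≤-trans (s≤s z≤n) 2≤)) 2≤)

  largest-repeated : largestRepeated π ≡ 0 ⊎ 2 ≤ mult (largestRepeated π) π
  largest-repeated with argmax-sel id 0 (filter repeated? (parts π))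
  ... | inj₁ eq = inj₁ eq
  ... | inj₂ r∈ = inj₂ (proj₂ (∈-filter⁻ repeated? {xs = parts π} r∈))

  Profile-largestRepeated : ∀ {r} → 2 ∣ r → Profile r (parts π) → largestRepeated π ≡ r
  Profile-largestRepeated {zero} _ P with largest-repeated
  ... | inj₁ eq = eq
  ... | inj₂ 2≤ = n≤0⇒n≡0 (≮⇒≥ λ 0<r → <⇒≱ 2≤ (above P _ 0<r))
  Profile-largestRepeated {r@(suc _)} 2∣r P with largest-repeated
  ... | inj₁ eq = contradiction
    (subst (r ≤_) eq (repeated≤largest (even-below P r 2∣r (s≤s z≤n) ≤-refl))) λ ()
  ... | inj₂ 2≤ = ≤-antisym (≮⇒≥ λ r<l → <⇒≱ 2≤ (above P _ r<l))
    (repeated≤largest (even-below P r 2∣r (s≤s z≤n) ≤-refl))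

  Ladder⇒𝒜₂ : ∀ {r} → Ladder r (parts π) → 𝒜₂ π
  Ladder⇒𝒜₂ {r} L = record
    { odd-distinct  = odd
    ; odd-absent    = λ j 2∤j j<R → odd-below P j 2∤j (subst (j <_) R≡r j<R)
    ; even-repeated = λ j 2∣j 0<j j<R → even-below P j 2∣j 0<j (<⇒≤ (subst (j <_) R≡r j<R))
    }
    where
    P = Ladder-Profile L
    R≡r = Profile-largestRepeated (Ladder-even L) P
    odd : ∀ j → 2 ∤ j → mult j π ≤ 1
    odd j 2∤j with <-cmp j r
    ... | tri< j<r _ _    = ≤-trans (≤-reflexive (odd-below P j 2∤j j<r)) z≤n
    ... | tri≈ _ refl _   = contradiction (Ladder-even L) 2∤j
    ... | tri> _ _ r<j    = above P j r<j

  𝒜₂⇒Ladder : 𝒜₂ π → Ladder (largestRepeated π) (parts π)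
  𝒜₂⇒Ladder a = Profile-Ladder r 2∣r (nonincreasing π) (positive π) record
    { odd-below  = odd-absent
    ; even-below = λ j 2∣j 0<j j≤r → even j 2∣j 0<j (m≤n⇒m<n∨m≡n j≤r)
    ; above      = λ j r<j → ≮⇒≥ λ 2≤ → <⇒≱ r<j (repeated≤largest 2≤)
    }
    where
    open 𝒜₂ a
    r = largestRepeated π
    2∣r : 2 ∣ r
    2∣r with largest-repeated | 2 ∣? r
    ... | _       | yes 2∣r = 2∣r
    ... | inj₁ eq | no  2∤r = contradiction (subst (2 ∣_) (sym eq) (2 ∣0)) 2∤r
    ... | inj₂ 2≤ | no  2∤r = contradiction (odd-distinct r 2∤r) (<⇒≱ 2≤)
    even : ∀ j → 2 ∣ j → 0 < j → j < r ⊎ j ≡ r → 2 ≤ mult j π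
    even j 2∣j 0<j (inj₁ j<r) = even-repeated j 2∣j 0<j j<r
    -- `𝒜₂` speaks only of j below r; r itself is repeated by its definition.
    even j 2∣j 0<j (inj₂ j≡r) with largest-repeated
    ... | inj₁ r≡0 = contradiction (trans j≡r r≡0) (<⇒≢ 0<j ∘ sym)
    ... | inj₂ 2≤  = subst (λ i → 2 ≤ mult i π) (sym j≡r) 2≤

-- Transfer from words to partitions.

Partition-≡ : ∀ {π σ} → parts π ≡ parts σ → π ≡ σ
Partition-≡ {mkPartition xs n p} {mkPartition _ n′ p′} refl =
  cong₂ (mkPartition xs) (Linked.irrelevant ≤-irrelevant n n′) (All.irrelevant ≤-irrelevant p p′)

Ladder-nonincreasing : ∀ {r xs} → Ladder r xs → Linked _≥_ xs
Ladder-nonincreasing (distinct dec _)     = Linked.map <⇒≤ dec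
Ladder-nonincreasing (step {xs = xs} {m} L _) = widen-nonincreasing m (Ladder-nonincreasing L)
  where
  widen-nonincreasing : ∀ m {xs} → Linked _≥_ xs → Linked _≥_ (widen m xs)
  widen-nonincreasing m             (y≤x ∷ ls) = s≤s (s≤s y≤x) ∷ widen-nonincreasing m ls
  widen-nonincreasing zero          [-]        = [-]
  widen-nonincreasing (suc m)       [-]        = s≤s (s≤s z≤n) ∷ widen-nonincreasing (suc m) []
  widen-nonincreasing zero          []         = []
  widen-nonincreasing (suc zero)    []         = [-]
  widen-nonincreasing (suc (suc m)) []         = ≤-refl ∷ widen-nonincreasing (suc m) []

𝒢₂-word : ∀ {π} → 𝒢₂ π → ∃ λ w → Valid w × word-parts w ≡ parts π
𝒢₂-word {π} g = word-of (nonincreasing π) (positive π) (𝒢₂.mult-one g , 𝒢₂.mult-adjacent g)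

-- Both lists are nonincreasing, and sorted lists that are permutations of each other coincide.
parts-f-≡ : ∀ {w} → Valid w → ∀ π → word-parts w ≡ parts π → parts (f π) ≡ image w
parts-f-≡ v π eq = Pointwise-≡⇒≡ (↗↭↗⇒≋ (Flip.totalOrder ≤-totalOrder)
  (nonincreasing (f π)) (Ladder-nonincreasing (proj₂ (image-Ladder v))) (↭⇒↭ₛ (parts-f v π eq)))

f-maps : ∀ π → 𝒢₂ π → 𝒜₂ (f π)
f-maps π g =
  let w , v , eq = 𝒢₂-word g
      r , L      = image-Ladder v
  in Ladder⇒𝒜₂ (f π) (subst (Ladder r) (sym (parts-f-≡ v π eq)) L)

f-injective : ∀ {π σ} → 𝒢₂ π → 𝒢₂ σ → f π ≡ f σ → π ≡ σ
f-injective {π} {σ} g h fπ≡fσ =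
  let w  , v  , eq  = 𝒢₂-word g
      w′ , v′ , eq′ = 𝒢₂-word h
      w≡w′ = image-injective v v′
        (trans (sym (parts-f-≡ v π eq)) (trans (cong parts fπ≡fσ) (parts-f-≡ v′ σ eq′)))
  in Partition-≡ (trans (sym eq) (trans (cong word-parts w≡w′) eq′))

f-surjective : ∀ σ → 𝒜₂ σ → ∃ λ π → 𝒢₂ π × f π ≡ σ
f-surjective σ a =
  let w , v , eq = Ladder-preimage (𝒜₂⇒Ladder σ a)
      one , adj  = word-Is𝒢₂ v
      π          = mkPartition (word-parts w) (word-nonincreasing v) (word-positive v)
  in π , record { mult-one = one ; mult-adjacent = adj } , Partition-≡ (trans (parts-f-≡ v π refl) eq)

f-size : ∀ π → 𝒢₂ π → size (f π) ≡ size π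
f-size π g =
  let w , v , eq = 𝒢₂-word g
  in trans (cong sum (parts-f-≡ v π eq)) (trans (sum-image v) (cong sum eq))

restriction-bijective : ∀ {A B : Set} {P : A → Set} {Q : B → Set}
                        (g : A → B) (g-maps : ∀ x → P x → Q (g x)) →
                        (∀ {x y} → P x → P y → g x ≡ g y → x ≡ y) →
                        (∀ y → Q y → ∃ λ x → P x × g x ≡ y) →
                        Bijective (_≡_ on proj₁) (_≡_ on proj₁) (map {P = P} {Q = Q} g (λ {x} → g-maps x))
restriction-bijective g g-maps inj surj =
  (λ {(_ , p)} {(_ , q)} → inj p q) ,
  -- Surjectivity is required for every z equal to x in its first component, whatever its membership
  -- proof.
  λ (y , q) → let x , p , gx≡y = surj y q in (x , p) , λ z≡x → trans (cong g z≡x) gx≡y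

theorem4 : Σ[ f-maps ∈ (∀ π → 𝒢₂ π → 𝒜₂ (f π)) ]
    Bijective (_≡_ on proj₁) (_≡_ on proj₁) (map {P = 𝒢₂} {Q = 𝒜₂} f (λ {π} → f-maps π))
    × (∀ π → 𝒢₂ π → size (f π) ≡ size π)
theorem4 = f-maps , restriction-bijective {P = 𝒢₂} {Q = 𝒜₂} f f-maps f-injective f-surjective , f-size
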